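{- Let $p\geq 5$ be prime and $C_{E,p}:=\left(\frac{\log(p+1)}{\log p}-1\right)^{ -1}$. Every linear system $M\cdot x=a$ over $\mathbb{F}_p$, where $M$ is an $m\times n$ matrix (i.e. $m$ equations) with $d_M\geq C_{E,p}\cdot m^3$, has a solution $x\in\{0,1\}^n$.
   Context: For $v\in\mathbb{F}_p^n$, $\omega(v)$ is the number of nonzero coordinates of $v$; $d_M:=\min_{y\in\mathbb{F}_p^m,\,y\neq 0}\omega(y\cdot M)$. -}

module Defs where

open import Data.Nat using (ℕ; zero; suc; _+_; _*_; _^_; _≤_; NonZero)
open import Data.Nat.DivMod using (_%_)
open import Data.Fin using (Fin; toℕ)
open import Data.Bool using (Bool; true; false)
open import Relation.Nullary using (¬_; yes; no)
open import Relation.Binary.PropositionalEquality using (_≡_)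
import Data.Nat as N

-- F_p is modelled as Fin p; arithmetic is done on representatives in ℕ
-- and reduced modulo p.

Σ : (n : ℕ) → (Fin n → ℕ) → ℕ
Σ zero    f = 0
Σ (suc n) f = f Data.Fin.zero + Σ n (λ i → f (Data.Fin.suc i))

count : (n : ℕ) → (Fin n → Bool) → ℕ
count zero    f = 0
count (suc n) f with f Data.Fin.zero
... | true  = suc (count n (λ i → f (Data.Fin.suc i)))
... | false = count n (λ i → f (Data.Fin.suc i))

Matrix : ℕ → ℕ → ℕ → Set
Matrix p m n = Fin m → Fin n → Fin p

vecMat : ∀ {p m n} {{_ : NonZero p}} → (Fin m → Fin p) → Matrix p m n → Fin n → ℕ
vecMat {p} {m} y M j = Σ m (λ i → toℕ (y i) * toℕ (M i j)) % p

-- Hamming weight ω(v): number of nonzero coordinates (v given by ℕ-representatives < p)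
ω : (n : ℕ) → (Fin n → ℕ) → ℕ
ω n v = count n (λ j → isNonzero (v j))
  where
  isNonzero : ℕ → Bool
  isNonzero k with k N.≟ 0
  ... | yes _ = false
  ... | no  _ = true

Nonzero : ∀ {p m} → (Fin m → Fin p) → Set
Nonzero {p} {m} y = ¬ (∀ i → toℕ (y i) ≡ 0)

bit : Bool → ℕ
bit true  = 1
bit false = 0

Solves : ∀ {p m n} {{_ : NonZero p}} → Matrix p m n → (Fin m → Fin p) → (Fin n → Bool) → Set
Solves {p} {m} {n} M a x =
  ∀ i → Σ n (λ j → toℕ (M i j) * bit (x j)) % p ≡ toℕ (a i)

-- "d ≥ C_{E,p} · m^3" with C_{E,p} = (log(p+1)/log p - 1)^{-1} = log p / (log(p+1) - log p).
-- Since log(p+1) > log p > 0 this is exactly d·log(p+1) ≥ (d + m^3)·log p,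
-- i.e. p^(d + m^3) ≤ (p+1)^d.
AboveCE : (p m d : ℕ) → Set
AboveCE p m d = p ^ (d + m ^ 3) ≤ (suc p) ^ d

{-# OPTIONS --safe #-}

-- Read the columns from left to right and maintain a set S of subset sums of
-- the prefix read so far.  Let v be the next column, nonzero mod p.  If S
-- contains no full coset of the line ⟨v⟩, then every nonempty trace of S on
-- such a coset has a boundary point, so |S ∪ (S + v)| ≥ (1 + 1/p) |S|.  If S
-- does contain a coset s + ⟨v⟩, it suffices to solve the system modulo ⟨v⟩ with
-- the remaining columns, the missing multiple of v being supplied by S; this is
-- a system with one equation less, handled by induction.  Since |S| ≤ p^m, the
-- number k of nonzero columns spent satisfies (1 + 1/p)^k ≤ p^m, so the weight
-- condition loses a factor p^m only, and m + (m - 1)^3 ≤ m^3.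
module Submission where

open import Defs
open import Data.Nat using (ℕ; zero; suc; pred; _+_; _*_; _^_; _≤_; z≤n; s≤s; NonZero; ≢-nonZero; nonTrivial⇒n>1; _≟_)
open import Data.Nat.Properties hiding (_≟_)
open import Data.Nat.DivMod
open import Data.Nat.Primality using (Prime; prime⇒nonTrivial)
open import Data.Nat.Coprimality using (prime⇒coprime; coprime-Bézout)
open import Data.Nat.GCD using (module Bézout)
open import Data.Nat.Tactic.RingSolver using (solve-∀)
open import Data.Fin using (Fin; zero; suc; toℕ; fromℕ<; punchIn; punchOut; combine; remQuot; funToFin; finToFun)
open import Data.Fin.Properties using (all?; ¬∀⟶∃¬; toℕ-fromℕ<; toℕ<n; punchIn-punchOut; injective⇒≤; remQuot-combine; finToFun-funToFin)
import Data.Fin.Properties as Finₚ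
open import Data.Vec.Functional using (insertAt) renaming (_∷_ to _◂_)
open import Data.Vec.Functional.Properties using (insertAt-lookup; insertAt-punchIn)
open import Data.List using (List; []; _∷_; [_]; _++_; map; filter; length; lookup)
open import Data.List.Properties using (length-++; length-map)
open import Data.List.Relation.Unary.All as All using ([]; _∷_)
open import Data.List.Relation.Unary.All.Properties using (¬Any⇒All¬)
open import Data.List.Relation.Unary.Any as Any using (here; there)
open import Data.List.Relation.Unary.Any.Properties using (lookup-index)
open import Data.List.Membership.Propositional.Properties using (∈-lookup)
import Data.List.Membership.Setoid as Membership
import Data.List.Membership.Setoid.Properties as Membershipₚ
import Data.List.Relation.Unary.Unique.Setoid as Uniqueness
import Data.List.Relation.Unary.Unique.Setoid.Properties as Uniqueₚ
open import Data.Bool using (Bool; true; false)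
open import Data.Product using (∃; ∃-syntax; _×_; _,_; proj₁; proj₂)
open import Data.Sum using (_⊎_; inj₁; inj₂)
open import Function using (_∘_)
open import Level using (0ℓ)
open import Relation.Binary using (Setoid)
open import Relation.Nullary using (¬_; yes; no; Dec; contradiction)
open import Relation.Nullary.Decidable using (¬?; decidable-stable)
open import Relation.Binary.PropositionalEquality using (_≡_; _≢_; _≗_; refl; sym; trans; cong; cong₂; subst; module ≡-Reasoning)
import Relation.Binary.Reasoning.Setoid as SetoidReasoning

-- Finite sums and counting.

Σ-cong : ∀ n {f g : Fin n → ℕ} → f ≗ g → Σ n f ≡ Σ n g
Σ-cong zero    f≗g = refl
Σ-cong (suc n) f≗g = cong₂ _+_ (f≗g zero) (Σ-cong n (f≗g ∘ suc))

Σ-zero : ∀ n → Σ n (λ _ → 0) ≡ 0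
Σ-zero zero    = refl
Σ-zero (suc n) = Σ-zero n

+-interchange : ∀ a b c d → (a + b) + (c + d) ≡ (a + c) + (b + d)
+-interchange = solve-∀

Σ-+ : ∀ n (f g : Fin n → ℕ) → Σ n (λ i → f i + g i) ≡ Σ n f + Σ n g
Σ-+ zero    f g = refl
Σ-+ (suc n) f g = begin
  (f zero + g zero) + Σ n (λ i → f (suc i) + g (suc i))
    ≡⟨ cong ((f zero + g zero) +_) (Σ-+ n (f ∘ suc) (g ∘ suc)) ⟩
  (f zero + g zero) + (Σ n (f ∘ suc) + Σ n (g ∘ suc))
    ≡⟨ +-interchange (f zero) (g zero) _ _ ⟩
  Σ (suc n) f + Σ (suc n) g ∎
  where open ≡-Reasoning

Σ-*ˡ : ∀ n c (f : Fin n → ℕ) → Σ n (λ i → c * f i) ≡ c * Σ n f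
Σ-*ˡ zero    c f = sym (*-zeroʳ c)
Σ-*ˡ (suc n) c f =
  trans (cong (c * f zero +_) (Σ-*ˡ n c (f ∘ suc))) (sym (*-distribˡ-+ c (f zero) _))

Σ-*ʳ : ∀ n c (f : Fin n → ℕ) → Σ n (λ i → f i * c) ≡ Σ n f * c
Σ-*ʳ n c f =
  trans (Σ-cong n (λ i → *-comm (f i) c)) (trans (Σ-*ˡ n c f) (*-comm c (Σ n f)))

Σ-punchIn : ∀ n (i : Fin (suc n)) (f : Fin (suc n) → ℕ) → Σ (suc n) f ≡ f i + Σ n (f ∘ punchIn i)
Σ-punchIn n       zero    f = refl
Σ-punchIn (suc n) (suc i) f =
  trans (cong (f zero +_) (Σ-punchIn n i (f ∘ suc))) (swap (f zero) (f (suc i)) _)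
  where
  swap : ∀ a b c → a + (b + c) ≡ b + (a + c)
  swap = solve-∀

count-cong : ∀ n {f g : Fin n → Bool} → f ≗ g → count n f ≡ count n g
count-cong zero    f≗g = refl
count-cong (suc n) {f} {g} f≗g with f zero | g zero | f≗g zero
... | true  | true  | refl = cong suc (count-cong n (f≗g ∘ suc))
... | false | false | refl = count-cong n (f≗g ∘ suc)

nonzero : ℕ → Bool
nonzero zero    = false
nonzero (suc _) = true

ω≡count-nonzero : ∀ n (v : Fin n → ℕ) → ω n v ≡ count n (nonzero ∘ v)
ω≡count-nonzero n v = trans (proj₂ ω-test) (count-cong n test≗nonzero)
  where
  -- Names the test that is local to the definition of ω.
  ω-test : ∃[ test ] ω n v ≡ count n test
  ω-test = _ , refl
  test≗nonzero : proj₁ ω-test ≗ nonzero ∘ v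
  test≗nonzero j with v j
  ... | zero  = refl
  ... | suc _ = refl

-- The weight threshold in its integer form.

-- Raising `d` by `o` multiplies the left side by `p ^ o` and the right side by the larger
-- `suc p ^ o`.
AboveCE-mono : ∀ p m {d e} → d ≤ e → AboveCE p m d → AboveCE p m e
AboveCE-mono p m {d} {e} d≤e h with m≤n⇒∃[o]m+o≡n d≤e
... | o , refl = begin
  p ^ (d + o + m ^ 3)      ≡⟨ cong (p ^_) (shift d o (m ^ 3)) ⟩
  p ^ (o + (d + m ^ 3))    ≡⟨ ^-distribˡ-+-* p o _ ⟩
  p ^ o * p ^ (d + m ^ 3)  ≤⟨ *-mono-≤ (^-monoˡ-≤ o (n≤1+n p)) h ⟩
  suc p ^ o * suc p ^ d    ≡⟨ ^-distribˡ-+-* (suc p) o d ⟨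
  suc p ^ (o + d)          ≡⟨ cong (suc p ^_) (+-comm o d) ⟩
  suc p ^ (d + o)          ∎
  where
  open ≤-Reasoning
  shift : ∀ d o c → d + o + c ≡ o + (d + c)
  shift = solve-∀

-- Bookkeeping for losing one equation after `k` spent columns. By `small` these account for a
-- factor of at most `p ^ suc m` in `(1 + 1/p) ^ k`, and the drop from `suc m ^ 3` to `m ^ 3` pays
-- for it, with `3m² + 2m` to spare in the exponent.
AboveCE-descend : ∀ p .{{_ : NonZero p}} m k w →
  suc p ^ k ≤ p ^ (suc m + k) → AboveCE p (suc m) (k + w) → AboveCE p m w
AboveCE-descend p m k w small h = *-cancelˡ-≤ (p ^ (suc m + k)) {{m^n≢0 p (suc m + k)}} (begin
  p ^ (suc m + k) * p ^ (w + m ^ 3)      ≡⟨ ^-distribˡ-+-* p (suc m + k) _ ⟨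
  p ^ (suc m + k + (w + m ^ 3))          ≤⟨ ^-monoʳ-≤ p exponent ⟩
  p ^ (k + w + suc m ^ 3)                ≤⟨ h ⟩
  suc p ^ (k + w)                        ≡⟨ ^-distribˡ-+-* (suc p) k w ⟩
  suc p ^ k * suc p ^ w                  ≤⟨ *-monoˡ-≤ _ small ⟩
  p ^ (suc m + k) * suc p ^ w            ∎)
  where
  open ≤-Reasoning
  cube : ∀ m k w → k + w + suc m * (suc m * (suc m * 1)) ≡
    (suc m + k + (w + m * (m * (m * 1)))) + (3 * (m * m) + 2 * m)
  cube = solve-∀
  exponent : suc m + k + (w + m ^ 3) ≤ k + w + suc m ^ 3
  exponent = begin
    suc m + k + (w + m ^ 3)                              ≤⟨ m≤m+n _ _ ⟩
    (suc m + k + (w + m ^ 3)) + (3 * (m * m) + 2 * m)    ≡⟨ cube m k w ⟨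
    k + w + suc m ^ 3                                    ∎

-- Pigeonhole for duplicate-free lists over a setoid.

module _ (S : Setoid 0ℓ 0ℓ) where
  open Setoid S using (Carrier; _≈_) renaming (sym to ≈-sym)
  open Membership S using (_∈_)
  open Uniqueness S using (Unique; []; _∷_)

  Unique-lookup-injective : ∀ {xs} → Unique xs → ∀ i j → lookup xs i ≈ lookup xs j → i ≡ j
  Unique-lookup-injective (_ ∷ _)     zero    zero    _  = refl
  Unique-lookup-injective (x∉xs ∷ _)  zero    (suc j) eq = contradiction eq (All.lookup x∉xs (∈-lookup j))
  Unique-lookup-injective (x∉xs ∷ _)  (suc i) zero    eq = contradiction (≈-sym eq) (All.lookup x∉xs (∈-lookup i))
  Unique-lookup-injective (_ ∷ xs!)   (suc i) (suc j) eq = cong suc (Unique-lookup-injective xs! i j eq)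

  -- Choosing a label at each position gives an injection into `Fin N`: equal labels force
  -- equivalent entries, hence equal positions. Labelling is a relation, so the choice need not
  -- respect `≈`.
  length≤-by-labels : ∀ {xs N} (_labelled_ : Carrier → Fin N → Set) →
    (∀ {x y k} → x labelled k → y labelled k → x ≈ y) →
    Unique xs → (∀ {x} → x ∈ xs → ∃ (x labelled_)) → length xs ≤ N
  length≤-by-labels {xs} _labelled_ determines xs! label = injective⇒≤ {f = λ i → proj₁ (label (at i))} inj
    where
    at : ∀ i → lookup xs i ∈ xs
    at = Membershipₚ.∈-lookup S xs
    inj : ∀ {i j} → proj₁ (label (at i)) ≡ proj₁ (label (at j)) → i ≡ j
    inj {i} {j} eq = Unique-lookup-injective xs! i j
      (determines (proj₂ (label (at i))) (subst (lookup xs j labelled_) (sym eq) (proj₂ (label (at j)))))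

module Modular (p : ℕ) {{_ : NonZero p}} where

  -- Arithmetic modulo p on natural representatives.

  infix 4 _≈_ _≋_

  _≈_ : ℕ → ℕ → Set
  a ≈ b = a % p ≡ b % p

  ≈-setoid : Setoid 0ℓ 0ℓ
  ≈-setoid = record
    { Carrier = ℕ ; _≈_ = _≈_
    ; isEquivalence = record { refl = refl ; sym = sym ; trans = trans } }

  module ≈-Reasoning = SetoidReasoning ≈-setoid

  ≡⇒≈ : ∀ {a b} → a ≡ b → a ≈ b
  ≡⇒≈ = cong (_% p)

  +-cong-≈ : ∀ a b c d → a ≈ b → c ≈ d → a + c ≈ b + d
  +-cong-≈ a b c d a≈b c≈d = begin
    (a + c) % p             ≡⟨ %-distribˡ-+ a c p ⟩
    (a % p + c % p) % p     ≡⟨ cong₂ (λ x y → (x + y) % p) a≈b c≈d ⟩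
    (b % p + d % p) % p     ≡⟨ %-distribˡ-+ b d p ⟨
    (b + d) % p             ∎
    where open ≡-Reasoning

  *-cong-≈ : ∀ a b c d → a ≈ b → c ≈ d → a * c ≈ b * d
  *-cong-≈ a b c d a≈b c≈d = begin
    (a * c) % p               ≡⟨ %-distribˡ-* a c p ⟩
    ((a % p) * (c % p)) % p   ≡⟨ cong₂ (λ x y → (x * y) % p) a≈b c≈d ⟩
    ((b % p) * (d % p)) % p   ≡⟨ %-distribˡ-* b d p ⟨
    (b * d) % p               ∎
    where open ≡-Reasoning

  Σ-cong-≈ : ∀ n {f g : Fin n → ℕ} → (∀ i → f i ≈ g i) → Σ n f ≈ Σ n g
  Σ-cong-≈ zero    f≈g = refl
  Σ-cong-≈ (suc n) f≈g = +-cong-≈ _ _ _ _ (f≈g zero) (Σ-cong-≈ n (f≈g ∘ suc))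

  -- The additive inverse modulo p, written as `(p - 1) * a` to stay within the semiring ℕ.
  neg : ℕ → ℕ
  neg a = pred p * a

  0%p≡0 : 0 % p ≡ 0
  0%p≡0 = m*n%n≡0 0 p

  m*p≈0 : ∀ m → m * p ≈ 0
  m*p≈0 m = [m+kn]%n≡m%n 0 m p

  +-inverse-≈ : ∀ a → a + neg a ≈ 0
  +-inverse-≈ a = trans (≡⇒≈ (trans (cong (_* a) (suc-pred p)) (*-comm p a))) (m*p≈0 a)

  absorb-inverse : ∀ a b → a + (b + neg b) ≈ a
  absorb-inverse a b = trans (+-cong-≈ a a _ 0 refl (+-inverse-≈ b)) (≡⇒≈ (+-identityʳ a))

  +-cancelʳ-≈ : ∀ a b c → a + c ≈ b + c → a ≈ b
  +-cancelʳ-≈ a b c h = begin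
    a                  ≈⟨ absorb-inverse a c ⟨
    a + (c + neg c)    ≡⟨ +-assoc a c _ ⟨
    (a + c) + neg c    ≈⟨ +-cong-≈ _ _ _ _ h refl ⟩
    (b + c) + neg c    ≡⟨ +-assoc b c _ ⟩
    b + (c + neg c)    ≈⟨ absorb-inverse b c ⟩
    b                  ∎
    where open ≈-Reasoning

  inverse : Prime p → ∀ a → ¬ a ≈ 0 → ∃[ w ] w * a ≈ 1
  inverse p-prime a a≉0 with coprime-Bézout (prime⇒coprime p-prime {{≢-nonZero a%p≢0}} (m%n<n a p))
    where
    a%p≢0 : a % p ≢ 0
    a%p≢0 eq = a≉0 (trans eq (sym 0%p≡0))
  -- Here `1 + y * (a % p)` is a multiple of p, so `y` inverts `a` up to sign.
  ... | Bézout.+- x y eq = neg y , (begin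
    neg y * a                 ≈⟨ *-cong-≈ (neg y) (neg y) _ a refl (m%n%n≡m%n a p) ⟨
    neg y * (a % p)           ≡⟨ *-assoc (pred p) y _ ⟩
    neg (y * (a % p))         ≈⟨ +-cancelʳ-≈ _ _ (y * (a % p)) cancelled ⟩
    1                         ∎)
    where
    open ≈-Reasoning
    cancelled : neg (y * (a % p)) + y * (a % p) ≈ 1 + y * (a % p)
    cancelled = begin
      neg (y * (a % p)) + y * (a % p)   ≡⟨ +-comm _ (y * (a % p)) ⟩
      y * (a % p) + neg (y * (a % p))   ≈⟨ +-inverse-≈ _ ⟩
      0                                 ≈⟨ m*p≈0 x ⟨
      x * p                             ≡⟨ eq ⟨
      1 + y * (a % p)                   ∎
  ... | Bézout.-+ x y eq = y , (begin
    y * a          ≈⟨ *-cong-≈ y y _ a refl (m%n%n≡m%n a p) ⟨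
    y * (a % p)    ≡⟨ eq ⟨
    1 + x * p      ≈⟨ [m+kn]%n≡m%n 1 x p ⟩
    1              ∎)
    where open ≈-Reasoning

  -- Vectors modulo p, and lists of them as finite sets.

  Vector : ℕ → Set
  Vector m = Fin m → ℕ

  _≋_ : ∀ {m} → Vector m → Vector m → Set
  u ≋ v = ∀ i → u i ≈ v i

  ≋-setoid : ℕ → Setoid 0ℓ 0ℓ
  ≋-setoid m = record
    { Carrier = Vector m ; _≈_ = _≋_
    ; isEquivalence = record
      { refl  = λ i → refl
      ; sym   = λ u≋v i → sym (u≋v i)
      ; trans = λ u≋v v≋w i → trans (u≋v i) (v≋w i) } }

  _≋?_ : ∀ {m} (u v : Vector m) → Dec (u ≋ v)
  u ≋? v = all? (λ i → u i % p ≟ v i % p)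

  _⊕_·_ : ∀ {m} → Vector m → ℕ → Vector m → Vector m
  (u ⊕ t · v) i = u i + t * v i

  ⊕-congˡ : ∀ {m} {u u′ : Vector m} t v → u ≋ u′ → u ⊕ t · v ≋ u′ ⊕ t · v
  ⊕-congˡ t v u≋u′ i = +-cong-≈ _ _ _ _ (u≋u′ i) refl

  ⊕-cancel : ∀ {m} {u u′ : Vector m} t v → u ⊕ t · v ≋ u′ ⊕ t · v → u ≋ u′
  ⊕-cancel t v h i = +-cancelʳ-≈ _ _ _ (h i)

  ⊕-suc : ∀ {m} (u : Vector m) t v → (u ⊕ t · v) ⊕ 1 · v ≋ u ⊕ suc t · v
  ⊕-suc u t v i = ≡⇒≈ (step (u i) t (v i))
    where
    step : ∀ a t b → (a + t * b) + 1 * b ≡ a + suc t * b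
    step = solve-∀

  module _ {m : ℕ} where
    open Membership (≋-setoid m) public using (_∈_)
    open Uniqueness (≋-setoid m) public using (Unique)
    open Setoid (≋-setoid m) public using () renaming (refl to ≋-refl; sym to ≋-sym; trans to ≋-trans)

    ∈-resp-≋ : ∀ {S : List (Vector m)} {u v} → u ≋ v → u ∈ S → v ∈ S
    ∈-resp-≋ = Membershipₚ.∈-resp-≈ (≋-setoid m)

    _∈?_ : ∀ u (S : List (Vector m)) → Dec (u ∈ S)
    u ∈? S = Any.any? (u ≋?_) S

  residues : ∀ {m} → Vector m → Fin m → Fin p
  residues u i = fromℕ< (m%n<n (u i) p)

  toℕ-residues : ∀ {m} (u : Vector m) i → toℕ (residues u i) ≡ u i % p
  toℕ-residues u i = toℕ-fromℕ< (m%n<n (u i) p)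

  Unique⇒length≤p^m : ∀ {m} {S : List (Vector m)} → Unique S → length S ≤ p ^ m
  Unique⇒length≤p^m {m} S! = length≤-by-labels (≋-setoid m)
    (λ u k → ∀ i → u i % p ≡ toℕ (finToFun {p} {m} k i))
    (λ u~k v~k i → trans (u~k i) (sym (v~k i)))
    S!
    (λ {u} _ → funToFin (residues u) ,
      λ i → sym (trans (cong toℕ (finToFun-funToFin (residues u) i)) (toℕ-residues u i)))

  -- A missing vector could be put in front of `S`, giving a duplicate-free list longer than
  -- `p ^ m`.
  full⇒∈ : ∀ {m} {S : List (Vector m)} → Unique S → p ^ m ≤ length S → ∀ u → u ∈ S
  full⇒∈ {S = S} S! p^m≤ u = decidable-stable (u ∈? S)
    (λ u∉S → <⇒≱ (Unique⇒length≤p^m (¬Any⇒All¬ S u∉S ∷ S!)) p^m≤)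
    where open Uniqueness (≋-setoid _) using (_∷_)

  -- Growth of a set under translation by one vector.

  ContainsCoset : ∀ {m} → List (Vector m) → Vector m → Set
  ContainsCoset S v = ∃[ s ] (∀ t → s ⊕ t · v ∈ S)

  module _ {m : ℕ} (v : Vector m) {S : List (Vector m)} where

    exits? : ∀ (u : Vector m) → Dec (¬ u ⊕ 1 · v ∈ S)
    exits? u = ¬? ((u ⊕ 1 · v) ∈? S)

    exits-resp : ∀ {u u′ : Vector m} → u ≋ u′ → ¬ u ⊕ 1 · v ∈ S → ¬ u′ ⊕ 1 · v ∈ S
    exits-resp u≋u′ u∉ u′∈ = u∉ (∈-resp-≋ (⊕-congˡ 1 v (≋-sym u≋u′)) u′∈)

    boundary : List (Vector m)
    boundary = filter exits? S

    Exit : Vector m → Set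
    Exit s = ∃[ j ] s ⊕ toℕ {p} j · v ∈ boundary

    -- Move from `s` in steps of `v` until the next step would leave `S`. The bound `k ≤ p` keeps
    -- the number of steps before an exit below p, as `Exit` requires.
    walk : ∀ {s} → s ∈ S → ∀ k → k ≤ p → Exit s ⊎ (∀ j → j ≤ k → s ⊕ j · v ∈ S)
    walk {s} s∈S zero _ = inj₂ λ where
      zero z≤n → ∈-resp-≋ (λ i → ≡⇒≈ (sym (+-identityʳ (s i)))) s∈S
    walk {s} s∈S (suc k) k<p with walk s∈S k (<⇒≤ k<p)
    ... | inj₁ exit = inj₁ exit
    ... | inj₂ stay with exits? (s ⊕ k · v)
    ...   | yes out = inj₁ (fromℕ< k<p ,
              subst (λ j → s ⊕ j · v ∈ boundary) (sym (toℕ-fromℕ< k<p))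
                (Membershipₚ.∈-filter⁺ (≋-setoid m) exits? exits-resp (stay k ≤-refl) out))
    ...   | no ¬out = inj₂ λ j j≤ → extend j (m≤n⇒m<n∨m≡n j≤)
      where
      extend : ∀ j → suc j ≤ suc k ⊎ j ≡ suc k → s ⊕ j · v ∈ S
      extend j (inj₁ (s≤s j≤k)) = stay j j≤k
      extend j (inj₂ refl)      = ∈-resp-≋ (⊕-suc s k v) (decidable-stable (_ ∈? S) ¬out)

    -- A walk of p steps without exit has gone round the whole coset, since `t · v` depends only on
    -- `t % p`.
    coset-or-exit : ∀ {s} → s ∈ S → ContainsCoset S v ⊎ Exit s
    coset-or-exit {s} s∈S with walk s∈S p ≤-refl
    ... | inj₁ exit = inj₂ exit
    ... | inj₂ stay = inj₁ (s , λ t →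
            ∈-resp-≋ (λ i → +-cong-≈ _ _ _ _ refl (*-cong-≈ _ _ _ _ (m%n%n≡m%n t p) refl))
              (stay (t % p) (<⇒≤ (m%n<n t p))))

    -- `T` is kept apart from `S` so that the induction can shorten it while the boundary still
    -- refers to the fixed `S`.
    coset-or-all-exit : ∀ {T} → (∀ {s} → s ∈ T → s ∈ S) →
      ContainsCoset S v ⊎ (∀ {s} → s ∈ T → Exit s)
    coset-or-all-exit {[]}    T⊆S = inj₂ λ ()
    coset-or-all-exit {t ∷ T} T⊆S with coset-or-exit (T⊆S (here ≋-refl)) | coset-or-all-exit (T⊆S ∘ there)
    ... | inj₁ coset | _          = inj₁ coset
    ... | inj₂ _     | inj₁ coset = inj₁ coset
    ... | inj₂ (j , e) | inj₂ exits = inj₂ λ where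
      (here s≋t)  → j , ∈-resp-≋ (⊕-congˡ (toℕ j) v (≋-sym s≋t)) e
      (there s∈T) → exits s∈T

    -- An element of `S` is recovered from the boundary point it reaches and the number of steps
    -- taken, so these pairs serve as labels.
    length≤boundary*p : Unique S → (∀ {s} → s ∈ S → Exit s) → length S ≤ length boundary * p
    length≤boundary*p S! exit = length≤-by-labels (≋-setoid m)
      (λ s k → let (i , j) = remQuot {length boundary} p k in s ⊕ toℕ j · v ≋ lookup boundary i)
      (λ {s} {t} {k} s~k t~k → ⊕-cancel (toℕ (proj₂ (remQuot {length boundary} p k))) v (≋-trans s~k (≋-sym t~k)))
      S!
      (λ {s} s∈S → let (j , e) = exit s∈S in combine (Any.index e) j ,
        subst (λ (i , j) → s ⊕ toℕ j · v ≋ lookup boundary i)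
          (sym (remQuot-combine (Any.index e) j)) (lookup-index e))

    -- The union of `S` and `S + v` without repetitions: only boundary points have translates
    -- outside `S`.
    translates : List (Vector m)
    translates = S ++ map (_⊕ 1 · v) boundary

    translates-unique : Unique S → Unique translates
    translates-unique S! = Uniqueₚ.++⁺ (≋-setoid m) S!
      (Uniqueₚ.map⁺ (≋-setoid m) (≋-setoid m) (⊕-cancel 1 v) (Uniqueₚ.filter⁺ (≋-setoid m) exits? S!))
      (λ (x∈S , x∈map) →
        let (u , u∈ , x≋) = Membershipₚ.∈-map⁻ (≋-setoid m) (≋-setoid m) x∈map
        in proj₂ (Membershipₚ.∈-filter⁻ (≋-setoid m) exits? exits-resp {xs = S} u∈) (∈-resp-≋ x≋ x∈S))

    translates-origin : ∀ {x} → x ∈ translates → x ∈ S ⊎ (∃[ s ] s ∈ S × x ≋ s ⊕ 1 · v)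
    translates-origin x∈ with Membershipₚ.∈-++⁻ (≋-setoid m) S x∈
    ... | inj₁ x∈S   = inj₁ x∈S
    ... | inj₂ x∈map =
      let (u , u∈ , x≋) = Membershipₚ.∈-map⁻ (≋-setoid m) (≋-setoid m) x∈map
      in inj₂ (u , proj₁ (Membershipₚ.∈-filter⁻ (≋-setoid m) exits? exits-resp {xs = S} u∈) , x≋)

    translates-growth : length S ≤ length boundary * p → suc p * length S ≤ length translates * p
    translates-growth S≤ = begin
      length S + p * length S                     ≤⟨ +-monoˡ-≤ _ S≤ ⟩
      length boundary * p + p * length S          ≡⟨ rearrange (length boundary) p (length S) ⟩
      (length S + length boundary) * p            ≡⟨ cong (λ l → (length S + l) * p) (length-map (_⊕ 1 · v) boundary) ⟨
      (length S + length (map (_⊕ 1 · v) boundary)) * p  ≡⟨ cong (_* p) (length-++ S) ⟨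
      length translates * p                       ∎
      where
      open ≤-Reasoning
      rearrange : ∀ b p s → b * p + p * s ≡ (s + b) * p
      rearrange = solve-∀

    coset-or-growth : Unique S → ContainsCoset S v ⊎ suc p * length S ≤ length translates * p
    coset-or-growth S! with coset-or-all-exit (λ s∈S → s∈S)
    ... | inj₁ coset = inj₁ coset
    ... | inj₂ exit  = inj₂ (translates-growth (length≤boundary*p S! exit))

  -- Matrices, weights and subset sums of columns.

  IntMatrix : ℕ → ℕ → Set
  IntMatrix m n = Fin m → Fin n → ℕ

  column : ∀ {m n} → IntMatrix m n → Fin n → Vector m
  column M j i = M i j

  tail : ∀ {m n} → IntMatrix m (suc n) → IntMatrix m n
  tail M i j = M i (suc j)

  dot : ∀ {m} → Vector m → Vector m → ℕ
  dot {m} y v = Σ m (λ i → y i * v i)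

  weight : ∀ {m n} → Vector m → IntMatrix m n → ℕ
  weight {n = n} y M = count n (λ j → nonzero (dot y (column M j) % p))

  weight-tail-≤ : ∀ {m n} (y : Vector m) (M : IntMatrix m (suc n)) → weight y M ≤ suc (weight y (tail M))
  weight-tail-≤ y M with nonzero (dot y (column M zero) % p)
  ... | true  = ≤-refl
  ... | false = n≤1+n _

  weight-tail-≡ : ∀ {m n} (y : Vector m) (M : IntMatrix m (suc n)) →
    dot y (column M zero) ≈ 0 → weight y M ≡ weight y (tail M)
  weight-tail-≡ y M h rewrite h | 0%p≡0 = refl

  dot-zero : ∀ {m} (y v : Vector m) → v ≋ (λ _ → 0) → dot y v ≈ 0
  dot-zero {m} y v v≋0 = trans
    (Σ-cong-≈ m (λ i → trans (*-cong-≈ (y i) (y i) _ 0 refl (v≋0 i)) (≡⇒≈ (*-zeroʳ (y i)))))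
    (≡⇒≈ (Σ-zero m))

  combination : ∀ {m n} → IntMatrix m n → (Fin n → Bool) → Vector m
  combination {n = n} M x i = Σ n (λ j → M i j * bit (x j))

  -- `k` is a credit for columns already spent, each of which may have lowered the weight by one.
  WeightCondition : ∀ {m n} → ℕ → IntMatrix m n → Set
  WeightCondition {m} k M = ∀ (y : Vector m) → ∃ (λ i → ¬ y i ≈ 0) → AboveCE p m (k + weight y M)

  -- `S` plays the role of the sums from columns already read, `M` holds the columns to come. How
  -- the elements of `S` arose is not recorded; solutions are pulled back one column at a time
  -- instead.
  CoversFrom : ∀ {m n} → List (Vector m) → IntMatrix m n → Vector m → Set
  CoversFrom S M a = ∃[ s ] s ∈ S × ∃[ x ] (λ i → s i + combination M x i) ≋ a

  CoversFrom-skip : ∀ {m n} {S : List (Vector m)} (M : IntMatrix m (suc n)) {a} →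
    CoversFrom S (tail M) a → CoversFrom S M a
  CoversFrom-skip M (s , s∈S , x , h) = s , s∈S , false ◂ x ,
    λ i → trans (≡⇒≈ (drop-zero (s i) (M i zero) _)) (h i)
    where
    drop-zero : ∀ s v r → s + (v * 0 + r) ≡ s + r
    drop-zero = solve-∀

  CoversFrom-translates : ∀ {m n} {S : List (Vector m)} (M : IntMatrix m (suc n)) {a} →
    CoversFrom (translates (column M zero) {S}) (tail M) a → CoversFrom S M a
  CoversFrom-translates {S = S} M (s , s∈ , x , h) with translates-origin (column M zero) {S} s∈
  ... | inj₁ s∈S               = CoversFrom-skip M (s , s∈S , x , h)
  ... | inj₂ (u , u∈S , s≋u+v) = u , u∈S , true ◂ x , λ i → begin
    u i + (M i zero * 1 + combination (tail M) x i)   ≡⟨ regroup (u i) (M i zero) _ ⟩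
    (u i + 1 * M i zero) + combination (tail M) x i   ≈⟨ +-cong-≈ _ _ _ _ (s≋u+v i) refl ⟨
    s i + combination (tail M) x i                    ≈⟨ h i ⟩
    _                                                 ∎
    where
    open ≈-Reasoning
    regroup : ∀ u v r → u + (v * 1 + r) ≡ (u + 1 * v) + r
    regroup = solve-∀

  -- Removing one equation by row operations.

  module Elimination {m : ℕ} (pivot : Fin (suc m)) (c : Vector m) where

    eliminateVector : Vector (suc m) → Vector m
    eliminateVector v k = v (punchIn pivot k) + c k * v pivot

    eliminate : ∀ {n} → IntMatrix (suc m) n → IntMatrix m n
    eliminate M k j = eliminateVector (column M j) k

    -- The transpose of `eliminateVector`. It turns a row combination of the reduced system into one
    -- of the original system with the same values, so weight bounds pass to the reduced system.
    lift : Vector m → Vector (suc m)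
    lift y = insertAt y pivot (dot y c)

    dot-lift : ∀ y v → dot (lift y) v ≡ dot y (eliminateVector v)
    dot-lift y v = begin
      dot (lift y) v
        ≡⟨ Σ-punchIn m pivot (λ i → lift y i * v i) ⟩
      lift y pivot * v pivot + Σ m (λ k → lift y (punchIn pivot k) * v (punchIn pivot k))
        ≡⟨ cong₂ _+_ (cong (_* v pivot) (insertAt-lookup y pivot _))
             (Σ-cong m (λ k → cong (_* v (punchIn pivot k)) (insertAt-punchIn y pivot _ k))) ⟩
      dot y c * v pivot + Σ m (λ k → y k * v (punchIn pivot k))
        ≡⟨ cong (_+ Σ m (λ k → y k * v (punchIn pivot k))) (Σ-*ʳ m (v pivot) _) ⟨
      Σ m (λ k → y k * c k * v pivot) + Σ m (λ k → y k * v (punchIn pivot k))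
        ≡⟨ Σ-+ m _ _ ⟨
      Σ m (λ k → y k * c k * v pivot + y k * v (punchIn pivot k))
        ≡⟨ Σ-cong m (λ k → factor (y k) (c k) (v pivot) _) ⟩
      dot y (eliminateVector v) ∎
      where
      open ≡-Reasoning
      factor : ∀ y c p v → y * c * p + y * v ≡ y * (v + c * p)
      factor = solve-∀

    weight-lift : ∀ {n} y (M : IntMatrix (suc m) n) → weight (lift y) M ≡ weight y (eliminate M)
    weight-lift {n} y M = count-cong n (λ j → cong (λ d → nonzero (d % p)) (dot-lift y (column M j)))

    lift-nonzero : ∀ {y} → ∃ (λ k → ¬ y k ≈ 0) → ∃ (λ i → ¬ lift y i ≈ 0)
    lift-nonzero {y} (k , yk≉0) = punchIn pivot k ,
      λ eq → yk≉0 (trans (≡⇒≈ (sym (insertAt-punchIn y pivot _ k))) eq)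

    combination-eliminate : ∀ {n} (M : IntMatrix (suc m) n) x →
      combination (eliminate M) x ≗ eliminateVector (combination M x)
    combination-eliminate {n} M x k = begin
      Σ n (λ j → (M (punchIn pivot k) j + c k * M pivot j) * bit (x j))
        ≡⟨ Σ-cong n (λ j → expand (M (punchIn pivot k) j) (c k) (M pivot j) (bit (x j))) ⟩
      Σ n (λ j → M (punchIn pivot k) j * bit (x j) + c k * (M pivot j * bit (x j)))
        ≡⟨ Σ-+ n _ _ ⟩
      combination M x (punchIn pivot k) + Σ n (λ j → c k * (M pivot j * bit (x j)))
        ≡⟨ cong (combination M x (punchIn pivot k) +_) (Σ-*ˡ n (c k) _) ⟩
      eliminateVector (combination M x) k ∎
      where
      open ≡-Reasoning
      expand : ∀ r c s b → (r + c * s) * b ≡ r * b + c * (s * b)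
      expand = solve-∀

  -- The elimination whose kernel is the line spanned by v.
  module Projection {m : ℕ} (v : Vector (suc m)) (pivot : Fin (suc m)) (w : ℕ) (wv≈1 : w * v pivot ≈ 1) where

    -- The usual Gaussian factor: minus the entry of `v` in the row, divided by the pivot entry.
    multiplier : Vector m
    multiplier k = w * neg (v (punchIn pivot k))

    open Elimination pivot multiplier public

    kills-v : eliminateVector v ≋ (λ _ → 0)
    kills-v k = begin
      u + w * neg u * v pivot      ≡⟨ cong (u +_) (regroup w (neg u) (v pivot)) ⟩
      u + w * v pivot * neg u      ≈⟨ +-cong-≈ u u _ _ refl (*-cong-≈ _ 1 _ _ wv≈1 refl) ⟩
      u + 1 * neg u                ≡⟨ cong (u +_) (*-identityˡ (neg u)) ⟩
      u + neg u                    ≈⟨ +-inverse-≈ u ⟩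
      0                            ∎
      where
      open ≈-Reasoning
      u : ℕ
      u = v (punchIn pivot k)
      regroup : ∀ w n v → w * n * v ≡ w * v * n
      regroup = solve-∀

    kernel : ∀ r b → eliminateVector r ≋ eliminateVector b → ∃[ t ] r ⊕ t · v ≋ b
    kernel r b h = t , agree
      where
      open ≈-Reasoning
      t : ℕ
      -- The pivot coordinate forces this value: the difference of `b` and `r` there, divided by
      -- `v pivot`.
      t = w * (b pivot + neg (r pivot))
      at-pivot : r pivot + t * v pivot ≈ b pivot
      at-pivot = begin
        r pivot + t * v pivot                                ≡⟨ regroup (r pivot) w _ (v pivot) ⟩
        w * v pivot * (b pivot + neg (r pivot)) + r pivot    ≈⟨ +-cong-≈ _ _ _ _ (*-cong-≈ _ 1 _ _ wv≈1 refl) refl ⟩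
        1 * (b pivot + neg (r pivot)) + r pivot              ≡⟨ reassociate (b pivot) (neg (r pivot)) (r pivot) ⟩
        b pivot + (r pivot + neg (r pivot))                  ≈⟨ absorb-inverse (b pivot) (r pivot) ⟩
        b pivot                                              ∎
        where
        regroup : ∀ r w d v → r + w * d * v ≡ w * v * d + r
        regroup = solve-∀
        reassociate : ∀ b n r → 1 * (b + n) + r ≡ b + (r + n)
        reassociate = solve-∀
      off-pivot : ∀ k → r (punchIn pivot k) + t * v (punchIn pivot k) ≈ b (punchIn pivot k)
      -- Splitting `t` exposes the eliminated entry of `r`, which `h` exchanges for that of `b`; the
      -- remaining multiples of `u` cancel.
      off-pivot k = begin
        rₖ + t * u
          ≡⟨ split rₖ w (b pivot) (pred p) (r pivot) u ⟩
        (rₖ + w * neg u * r pivot) + w * b pivot * u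
          ≈⟨ +-cong-≈ _ _ _ _ (h k) refl ⟩
        (bₖ + w * neg u * b pivot) + w * b pivot * u
          ≡⟨ merge bₖ w (pred p) u (b pivot) ⟩
        bₖ + (w * b pivot * u + neg (w * b pivot * u))
          ≈⟨ absorb-inverse bₖ (w * b pivot * u) ⟩
        bₖ ∎
        where
        u rₖ bₖ : ℕ
        u  = v (punchIn pivot k)
        rₖ = r (punchIn pivot k)
        bₖ = b (punchIn pivot k)
        split : ∀ rₖ w b q r u → rₖ + w * (b + q * r) * u ≡ (rₖ + w * (q * u) * r) + w * b * u
        split = solve-∀
        merge : ∀ bₖ w q u b → (bₖ + w * (q * u) * b) + w * b * u ≡ bₖ + (w * b * u + q * (w * b * u))
        merge = solve-∀
      agree : r ⊕ t · v ≋ b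
      agree i with pivot Finₚ.≟ i
      ... | yes refl = at-pivot
      ... | no  pivot≢i = subst (λ i → (r ⊕ t · v) i ≈ b i) (punchIn-punchOut pivot≢i) (off-pivot (punchOut pivot≢i))

  -- The induction on equations and columns.

  Covers : ∀ {m n} → IntMatrix m n → Set
  Covers {m} M = ∀ (a : Vector m) → ∃[ x ] combination M x ≋ a

  module _ (p-prime : Prime p) where

    1≉0 : ¬ 1 ≈ 0
    1≉0 1≈0 = contradiction
      (trans (sym (m<n⇒m%n≡m (nonTrivial⇒n>1 p {{prime⇒nonTrivial p-prime}}))) (trans 1≈0 0%p≡0)) λ ()

    -- Without columns every weight is 0, so the weight condition at any nonzero vector, here the
    -- all-ones vector, bounds `(1 + 1/p) ^ k` from below by `p ^ (suc m ^ 3)`. The size of `S` is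
    -- at least that.
    all-columns-spent : ∀ {m} {S : List (Vector (suc m))} (M : IntMatrix (suc m) 0) k →
      suc p ^ k ≤ length S * p ^ k → WeightCondition k M → p ^ suc m ≤ length S
    all-columns-spent {m} {S} M k grown heavy = *-cancelʳ-≤ _ _ (p ^ k) {{m^n≢0 p k}} (begin
      p ^ suc m * p ^ k           ≡⟨ ^-distribˡ-+-* p (suc m) k ⟨
      p ^ (suc m + k)             ≤⟨ ^-monoʳ-≤ p exponent ⟩
      p ^ (k + 0 + suc m ^ 3)     ≤⟨ heavy (λ _ → 1) (zero , 1≉0) ⟩
      suc p ^ (k + 0)             ≡⟨ cong (suc p ^_) (+-identityʳ k) ⟩
      suc p ^ k                   ≤⟨ grown ⟩
      length S * p ^ k            ∎)
      where
      open ≤-Reasoning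
      exponent : suc m + k ≤ k + 0 + suc m ^ 3
      exponent = begin
        suc m + k             ≡⟨ cong₂ _+_ (*-identityʳ (suc m)) (+-identityʳ k) ⟨
        suc m ^ 1 + (k + 0)   ≤⟨ +-monoˡ-≤ _ (^-monoʳ-≤ (suc m) {1} {3} (s≤s z≤n)) ⟩
        suc m ^ 3 + (k + 0)   ≡⟨ +-comm (suc m ^ 3) _ ⟩
        k + 0 + suc m ^ 3     ∎

    covers-via-coset : ∀ {m} → (∀ {n} (M : IntMatrix m n) → WeightCondition 0 M → Covers M) →
      ∀ {n} (M : IntMatrix (suc m) (suc n)) k {S} → Unique S → suc p ^ k ≤ length S * p ^ k →
      WeightCondition k M → ∀ pivot → ¬ M pivot zero ≈ 0 → ContainsCoset S (column M zero) →
      ∀ a → CoversFrom S M a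
    covers-via-coset {m} covers M k {S} S! grown heavy pivot Mp≉0 (s , coset) a =
      CoversFrom-skip M (s ⊕ t · v , coset t , x , solved)
      where
      v : Vector (suc m)
      v = column M zero
      v-inverse : ∃[ w ] w * v pivot ≈ 1
      v-inverse = inverse p-prime (v pivot) Mp≉0
      open Projection v pivot (proj₁ v-inverse) (proj₂ v-inverse)
      few-spent : suc p ^ k ≤ p ^ (suc m + k)
      few-spent = begin
        suc p ^ k             ≤⟨ grown ⟩
        length S * p ^ k      ≤⟨ *-monoˡ-≤ (p ^ k) (Unique⇒length≤p^m S!) ⟩
        p ^ suc m * p ^ k     ≡⟨ ^-distribˡ-+-* p (suc m) k ⟨
        p ^ (suc m + k)       ∎
        where open ≤-Reasoning
      heavy′ : WeightCondition 0 (eliminate (tail M))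
      -- `lift y` is orthogonal to `v`, so dropping the current column costs no weight.
      heavy′ y y≉0 = AboveCE-descend p m k _ few-spent
        (subst (λ w → AboveCE p (suc m) (k + w))
          (trans (weight-tail-≡ (lift y) M (trans (≡⇒≈ (dot-lift y v)) (dot-zero y _ kills-v)))
                 (weight-lift y (tail M)))
          (heavy (lift y) (lift-nonzero y≉0)))
      b : Vector (suc m)
      -- The target minus the base point of the coset; it need only be met modulo the line of `v`.
      b i = a i + neg (s i)
      solution : ∃[ x ] combination (eliminate (tail M)) x ≋ eliminateVector b
      solution = covers (eliminate (tail M)) heavy′ (eliminateVector b)
      x : Fin _ → Bool
      x = proj₁ solution
      r : Vector (suc m)
      r = combination (tail M) x
      multiple : ∃[ t ] r ⊕ t · v ≋ b
      multiple = kernel r b (λ i → trans (≡⇒≈ (sym (combination-eliminate (tail M) x i))) (proj₂ solution i))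
      t : ℕ
      t = proj₁ multiple
      solved : (λ i → (s ⊕ t · v) i + r i) ≋ a
      solved i = begin
        (s i + t * v i) + r i     ≡⟨ regroup (s i) (t * v i) (r i) ⟩
        s i + (r i + t * v i)     ≈⟨ +-cong-≈ (s i) _ _ _ refl (proj₂ multiple i) ⟩
        s i + (a i + neg (s i))   ≡⟨ rotate (s i) (a i) _ ⟩
        a i + (s i + neg (s i))   ≈⟨ absorb-inverse (a i) (s i) ⟩
        a i                       ∎
        where
        open ≈-Reasoning
        regroup : ∀ s v r → (s + v) + r ≡ s + (r + v)
        regroup = solve-∀
        rotate : ∀ s a n → s + (a + n) ≡ a + (s + n)
        rotate = solve-∀

    -- Induction on the columns still to be read. The invariant is that `S` has at least
    -- `(1 + 1/p) ^ k` elements, where `k` counts the columns spent on enlarging it.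
    covers-from : ∀ {m} → (∀ {n} (M : IntMatrix m n) → WeightCondition 0 M → Covers M) →
      ∀ {n} (M : IntMatrix (suc m) n) k {S} → Unique S → suc p ^ k ≤ length S * p ^ k →
      WeightCondition k M → ∀ a → CoversFrom S M a
    covers-from covers {zero} M k {S} S! grown heavy a =
      -- `S` is now the whole space, so the target itself is in it and nothing is added.
      a , full⇒∈ S! (all-columns-spent {S = S} M k grown heavy) a , (λ ()) , λ i → ≡⇒≈ (+-identityʳ (a i))
    covers-from {m} covers {suc n} M k {S} S! grown heavy a with column M zero ≋? (λ _ → 0)
    -- A zero column carries no weight, so it is skipped with `k` unchanged.
    ... | yes v≋0 = CoversFrom-skip M (covers-from covers (tail M) k S! grown
      (λ y y≉0 → subst (λ w → AboveCE p (suc m) (k + w))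
        (weight-tail-≡ y M (dot-zero y _ v≋0)) (heavy y y≉0)) a)
    ... | no v≉0 with coset-or-growth (column M zero) S!
    ...   | inj₁ coset = let (pivot , Mp≉0) = ¬∀⟶∃¬ (suc m) _ (λ i → M i zero % p ≟ 0 % p) v≉0 in
      covers-via-coset covers M k S! grown heavy pivot Mp≉0 coset a
    ...   | inj₂ growth = CoversFrom-translates M
      (covers-from covers (tail M) (suc k) (translates-unique (column M zero) S!) grown′ heavy′ a)
      where
      open ≤-Reasoning
      T : List (Vector (suc m))
      T = translates (column M zero) {S}
      grown′ : suc p ^ suc k ≤ length T * p ^ suc k
      grown′ = begin
        suc p * suc p ^ k             ≤⟨ *-monoʳ-≤ (suc p) grown ⟩
        suc p * (length S * p ^ k)    ≡⟨ *-assoc (suc p) (length S) _ ⟨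
        suc p * length S * p ^ k      ≤⟨ *-monoˡ-≤ (p ^ k) growth ⟩
        length T * p * p ^ k          ≡⟨ *-assoc (length T) p _ ⟩
        length T * p ^ suc k          ∎
      heavy′ : WeightCondition (suc k) (tail M)
      heavy′ y y≉0 = AboveCE-mono p (suc m)
        (≤-trans (+-monoʳ-≤ k (weight-tail-≤ y M)) (≤-reflexive (+-suc k _))) (heavy y y≉0)

    covers : ∀ m {n} (M : IntMatrix m n) → WeightCondition 0 M → Covers M
    covers zero    M heavy a = (λ _ → false) , λ ()
    -- Start from the empty sum alone: one element and no column spent.
    covers (suc m) M heavy a with covers-from (covers m) M 0 {[ (λ _ → 0) ]} ([] ∷ []) ≤-refl heavy a
      where open Uniqueness (≋-setoid (suc m)) using ([]; _∷_)
    ... | s , here s≋0 , x , h = x , λ i → trans (+-cong-≈ 0 (s i) _ _ (sym (s≋0 i)) refl) (h i)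

theorem5p2 : (p : ℕ) → {{_ : NonZero p}} → Prime p → 5 ≤ p →
    (m n : ℕ) → (M : Matrix p m n) →
    -- d_M ≥ C_{E,p} · m^3, i.e. every nonzero y has ω(y·M) ≥ C_{E,p} · m^3
    (∀ (y : Fin m → Fin p) → Nonzero y → AboveCE p m (ω n (vecMat y M))) →
    (a : Fin m → Fin p) → ∃ λ (x : Fin n → Bool) → Solves M a x
theorem5p2 p p-prime _ m n M heavy a =
  let (x , solves) = covers p-prime m (λ i j → toℕ (M i j)) heavy′ (toℕ ∘ a)
  in x , λ i → trans (solves i) (m<n⇒m%n≡m (toℕ<n (a i)))
  where
  open Modular p
  heavy′ : WeightCondition 0 (λ i j → toℕ (M i j))
  -- `y` has arbitrary natural entries; reducing them modulo p changes neither its being nonzero nor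
  -- its weight.
  heavy′ y (i , yi≉0) = subst (AboveCE p m) same-weight (heavy (residues y) residues-nonzero)
    where
    residues-nonzero : Nonzero (residues y)
    residues-nonzero all0 = yi≉0 (trans (sym (toℕ-residues y i)) (trans (all0 i) (sym 0%p≡0)))
    same-entry : ∀ j → vecMat (residues y) M j ≡ dot y (λ i → toℕ (M i j)) % p
    same-entry j = Σ-cong-≈ m (λ i → *-cong-≈ _ (y i) (toℕ (M i j)) _
      (trans (≡⇒≈ (toℕ-residues y i)) (m%n%n≡m%n (y i) p)) refl)
    same-weight : ω n (vecMat (residues y) M) ≡ weight y (λ i j → toℕ (M i j))
    same-weight = trans (ω≡count-nonzero n _) (count-cong n (λ j → cong nonzero (same-entry j)))
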